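{- For every integer $n \geq 5$, $\sigma(K_5 - P_3, n) = 4n - 4$.
   Context: A sequence $S=(d_1,\dots,d_n)$ of non-negative integers is graphical if it is the degree sequence of some simple graph on $n$ vertices (a realization of $S$). A graphical sequence is potentially $H$-graphical if some realization of it contains $H$ as a subgraph. $\sigma(S)=d_1+\dots+d_n$. $P_3$ denotes a path on $4$ vertices (with $3$ edges), and $K_5 - P_3$ is the graph obtained from the complete graph $K_5$ by removing the $3$ edges of a path $P_3$. $\sigma(H,n)$ is the smallest even integer $l$ such that every $n$-term graphical sequence $S$ with $\sigma(S)\geq l$ is potentially $H$-graphical. -}

module Defs where

open import Data.Nat using (ℕ; zero; suc; _+_; _*_; _≤_; _≡ᵇ_; _≤ᵇ_)
open import Data.Nat.Divisibility using (_∣_)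
open import Data.Fin using (Fin; zero; suc; toℕ)
open import Data.Bool using (Bool; true; false; if_then_else_; _∧_; _∨_; not)
open import Data.List using (List; map; allFin)
open import Data.Nat.ListAction using (sum)
open import Data.Product using (Σ; _×_; _,_; ∃)
open import Function.Definitions using (Injective)
open import Relation.Binary.PropositionalEquality using (_≡_; refl)

record Graph (n : ℕ) : Set where
  field
    adj    : Fin n → Fin n → Bool
    sym    : ∀ u v → adj u v ≡ adj v u
    irrefl : ∀ v → adj v v ≡ false
open Graph public

deg : ∀ {n} → Graph n → Fin n → ℕ
deg {n} G v = sum (map (λ u → if adj G v u then 1 else 0) (allFin n))

Seq : ℕ → Set
Seq n = Fin n → ℕ

σ : ∀ n → Seq n → ℕ
σ n S = sum (map S (allFin n))

Realizes : ∀ n → Graph n → Seq n → Set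
Realizes n G S = ∀ i → deg {n} G i ≡ S i

Graphical : ∀ n → Seq n → Set
Graphical n S = Σ (Graph n) λ G → Realizes n G S

Contains : ∀ {k n} → Graph n → Graph k → Set
Contains {k} {n} G H =
  Σ (Fin k → Fin n) λ f → Injective _≡_ _≡_ f ×
    (∀ a b → adj H a b ≡ true → adj G (f a) (f b) ≡ true)

PotentiallyGraphical : ∀ k n → Graph k → Seq n → Set
PotentiallyGraphical k n H S =
  Σ (Graph n) λ G → Realizes n G S × Contains {k} {n} G H

SigmaProperty : ∀ k → Graph k → ℕ → ℕ → Set
SigmaProperty k H n l =
  ∀ (S : Seq n) → Graphical n S → l ≤ σ n S → PotentiallyGraphical k n H S

IsSigma : ∀ k → Graph k → ℕ → ℕ → Set
IsSigma k H n l =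
  (2 ∣ l) × SigmaProperty k H n l ×
  (∀ l′ → 2 ∣ l′ → SigmaProperty k H n l′ → l ≤ l′)

-- K5 - P3: vertices 0..4, remove the path 0-1-2-3 (edges 01, 12, 23).
pathEdge : ℕ → ℕ → Bool
pathEdge a b = (suc a ≡ᵇ b) ∧ (b ≤ᵇ 3)

K5-P3-adj : Fin 5 → Fin 5 → Bool
K5-P3-adj i j =
  not (toℕ i ≡ᵇ toℕ j) ∧ not (pathEdge (toℕ i) (toℕ j) ∨ pathEdge (toℕ j) (toℕ i))

K5-P3-sym : ∀ u v → K5-P3-adj u v ≡ K5-P3-adj v u
K5-P3-sym zero zero = refl
K5-P3-sym zero (suc zero) = refl
K5-P3-sym zero (suc (suc zero)) = refl
K5-P3-sym zero (suc (suc (suc zero))) = refl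
K5-P3-sym zero (suc (suc (suc (suc zero)))) = refl
K5-P3-sym (suc zero) zero = refl
K5-P3-sym (suc zero) (suc zero) = refl
K5-P3-sym (suc zero) (suc (suc zero)) = refl
K5-P3-sym (suc zero) (suc (suc (suc zero))) = refl
K5-P3-sym (suc zero) (suc (suc (suc (suc zero)))) = refl
K5-P3-sym (suc (suc zero)) zero = refl
K5-P3-sym (suc (suc zero)) (suc zero) = refl
K5-P3-sym (suc (suc zero)) (suc (suc zero)) = refl
K5-P3-sym (suc (suc zero)) (suc (suc (suc zero))) = refl
K5-P3-sym (suc (suc zero)) (suc (suc (suc (suc zero)))) = refl
K5-P3-sym (suc (suc (suc zero))) zero = refl
K5-P3-sym (suc (suc (suc zero))) (suc zero) = refl
K5-P3-sym (suc (suc (suc zero))) (suc (suc zero)) = refl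
K5-P3-sym (suc (suc (suc zero))) (suc (suc (suc zero))) = refl
K5-P3-sym (suc (suc (suc zero))) (suc (suc (suc (suc zero)))) = refl
K5-P3-sym (suc (suc (suc (suc zero)))) zero = refl
K5-P3-sym (suc (suc (suc (suc zero)))) (suc zero) = refl
K5-P3-sym (suc (suc (suc (suc zero)))) (suc (suc zero)) = refl
K5-P3-sym (suc (suc (suc (suc zero)))) (suc (suc (suc zero))) = refl
K5-P3-sym (suc (suc (suc (suc zero)))) (suc (suc (suc (suc zero)))) = refl

K5-P3-irrefl : ∀ v → K5-P3-adj v v ≡ false
K5-P3-irrefl zero = refl
K5-P3-irrefl (suc zero) = refl
K5-P3-irrefl (suc (suc zero)) = refl
K5-P3-irrefl (suc (suc (suc zero))) = refl
K5-P3-irrefl (suc (suc (suc (suc zero)))) = refl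

K5-P3 : Graph 5
K5-P3 = record { adj = K5-P3-adj ; sym = K5-P3-sym ; irrefl = K5-P3-irrefl }

{-# OPTIONS --safe #-}

-- K5 - P3 is the gem: a hub joined to all vertices of a path on four vertices.
--
-- The bound is sharp because a gem has three vertices of degree at least 3, whereas in the graph
-- K2 + (n - 2)K1 (the join), of degree sum 4n - 6, only two vertices have degree greater than 2.
--
-- For the upper bound, delete vertices of degree at most 2 one by one.  The inequality
-- 4 |W| - 4 <= (degree sum of G[W]) survives, so either all but one of five vertices form a K4 and a
-- gem is visible, or we reach a core W with at least five vertices and minimum degree 3.  A core has a
-- vertex of degree at least 4, and a gem then arises from a few degree-preserving 2-switches near that
-- vertex.  This last step is a finite case analysis on which pairs are adjacent, where the minimum
-- degree supplies new neighbours.  The inequality is needed there once more, since no realization of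
-- (4, 3, 3, 3, 3, 3, 3) contains a gem.

module Submission where

open import Defs
open import Data.Nat using (ℕ; zero; suc; _+_; _*_; _∸_; _≤_; _<_; z≤n; s≤s; _≤?_; _<?_)
open import Data.Nat.Properties as ℕ using (≤-refl; ≤-trans; ≤-reflexive; +-mono-≤; module ≤-Reasoning)
open import Data.Nat.ListAction using (sum)
open import Data.Nat.ListAction.Properties using (sum-↭)
open import Data.Nat.Divisibility using (_∣_; divides)
open import Data.Nat.Tactic.RingSolver using (solve-∀)
open import Data.Bool as Bool using (Bool; true; false; if_then_else_; _∧_; _∨_; not)
open import Data.Bool.Properties using (∨-comm; ∧-comm; ∨-zeroʳ; ∧-zeroʳ; ∨-identityʳ)
open import Data.Fin as Fin using (Fin; zero; suc; #_)
open import Data.Fin.Properties as Fin using (_≟_)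
open import Data.List as List using (List; []; _∷_; map; length; filter; allFin; _++_)
open import Data.List.Properties using (map-cong-local; map-∘; map-tabulate; length-map; length-tabulate)
open import Data.List.Membership.Propositional using (_∈_; find; lose)
open import Data.List.Membership.Propositional.Properties
  using (∈-∃++; ∈-map⁺; ∈-map⁻; ∈-filter⁺; ∈-filter⁻; ∈-allFin)
open import Data.List.Relation.Unary.All as All using (All; []; _∷_)
import Data.List.Relation.Unary.All.Properties as All
open import Data.List.Relation.Unary.Any as Any using (Any; here; there)
open import Data.List.Relation.Unary.AllPairs as AllPairs using ([]; _∷_)
open import Data.List.Relation.Unary.Unique.Propositional using (Unique)
import Data.List.Relation.Unary.Unique.Propositional.Properties as Unique
open import Data.List.Relation.Binary.Subset.Propositional using (_⊆_)
open import Data.List.Relation.Binary.Permutation.Propositional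
  using (_↭_; ↭-reflexive; ↭-trans; ↭-prep; ↭⇒↭ₛ)
open import Data.List.Relation.Binary.Permutation.Propositional.Properties
  using (shift; map⁺; ∈-resp-↭; ↭-length)
import Data.List.Relation.Binary.Permutation.Setoid.Properties as Permutationₛ
open import Data.Vec as Vec using (Vec; []; _∷_)
import Data.Vec.Relation.Unary.AllPairs as Vec using (allPairs?)
open import Data.Vec.Relation.Unary.Unique.Propositional.Properties using (lookup-injective)
open import Data.Product.Properties using (≡-dec)
open import Data.Product using (Σ; ∃; _×_; _,_; proj₁; proj₂)
open import Data.Sum using (_⊎_; inj₁; inj₂)
open import Function using (_∘_; _$_; id)
open import Function.Definitions using (Injective)
open import Relation.Nullary using (¬_; Dec; yes; no; does; contradiction)
open import Relation.Nullary.Decidable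
  using (True; toWitness; dec-true; dec-false; ¬?; _×-dec_; _⊎-dec_; _→-dec_; decidable-stable; from-yes)
open import Relation.Binary.PropositionalEquality as ≡
  using (_≡_; _≢_; refl; cong; cong₂; subst; module ≡-Reasoning)

private
  variable
    A : Set
    n k : ℕ

-- Sums and counts over lists.

∑ : (A → ℕ) → List A → ℕ
∑ f xs = sum (map f xs)

[_] : Bool → ℕ
[ b ] = if b then 1 else 0

count : (A → Bool) → List A → ℕ
count p = ∑ (λ x → [ p x ])

extract : ∀ {x : A} {xs} → x ∈ xs → ∃ λ ys → xs ↭ x ∷ ys
extract x∈xs with ys , zs , eq ← ∈-∃++ x∈xs = ys ++ zs , ↭-trans (↭-reflexive eq) (shift _ ys zs)

Unique-↭ : ∀ {xs ys : List A} → xs ↭ ys → Unique xs → Unique ys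
Unique-↭ {A = A} xs↭ys = Permutationₛ.Unique-resp-↭ (≡.setoid A) (↭⇒↭ₛ xs↭ys)

∑-↭ : ∀ (f : A → ℕ) {xs ys} → xs ↭ ys → ∑ f xs ≡ ∑ f ys
∑-↭ f = sum-↭ ∘ map⁺ f

∑-cong : ∀ {f g : A → ℕ} xs → (∀ {x} → x ∈ xs → f x ≡ g x) → ∑ f xs ≡ ∑ g xs
∑-cong xs = cong sum ∘ map-cong-local ∘ All.tabulate {xs = xs}

∑-mono : ∀ {f g : A → ℕ} xs → (∀ {x} → x ∈ xs → f x ≤ g x) → ∑ f xs ≤ ∑ g xs
∑-mono []       f≤g = z≤n
∑-mono (x ∷ xs) f≤g = +-mono-≤ (f≤g (here refl)) (∑-mono xs (f≤g ∘ there))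

∑-+ : ∀ (f g : A → ℕ) xs → ∑ (λ x → f x + g x) xs ≡ ∑ f xs + ∑ g xs
∑-+ f g []       = refl
∑-+ f g (x ∷ xs) = begin
  (f x + g x) + ∑ (λ x → f x + g x) xs ≡⟨ cong (f x + g x +_) (∑-+ f g xs) ⟩
  (f x + g x) + (∑ f xs + ∑ g xs)      ≡⟨ +-interchange (f x) (g x) (∑ f xs) (∑ g xs) ⟩
  (f x + ∑ f xs) + (g x + ∑ g xs)      ∎
  where open ≡-Reasoning
        open import Algebra.Properties.CommutativeSemigroup ℕ.+-commutativeSemigroup
          using () renaming (interchange to +-interchange)

∑-const : ∀ c (xs : List A) → ∑ (λ _ → c) xs ≡ length xs * c
∑-const c []       = refl
∑-const c (x ∷ xs) = cong (c +_) (∑-const c xs)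

⊆-tail : ∀ {x : A} {xs ys} → All (x ≢_) xs → x ∷ xs ⊆ x ∷ ys → xs ⊆ ys
⊆-tail x∉xs sub z∈xs with sub (there z∈xs)
... | here z≡x   = contradiction (≡.sym z≡x) (All.lookup x∉xs z∈xs)
... | there z∈ys = z∈ys

∑-⊆ : ∀ (f : A → ℕ) {xs ys} → Unique xs → xs ⊆ ys → ∑ f xs ≤ ∑ f ys
∑-⊆ f []                          sub = z≤n
∑-⊆ f {x ∷ xs} {ys} (x∉xs ∷ uniq) sub with zs , ys↭ ← extract (sub (here refl)) = begin
  f x + ∑ f xs ≤⟨ ℕ.+-monoʳ-≤ (f x) (∑-⊆ f uniq (⊆-tail x∉xs (∈-resp-↭ ys↭ ∘ sub))) ⟩
  f x + ∑ f zs ≡⟨ ∑-↭ f ys↭ ⟨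
  ∑ f ys       ∎
  where open ≤-Reasoning

length-⊆ : ∀ {xs ys : List A} → Unique xs → xs ⊆ ys → length xs ≤ length ys
length-⊆ {xs = xs} {ys} uniq sub = begin
  length xs         ≡⟨ ℕ.*-identityʳ _ ⟨
  length xs * 1     ≡⟨ ∑-const 1 xs ⟨
  ∑ (λ _ → 1) xs    ≤⟨ ∑-⊆ (λ _ → 1) uniq sub ⟩
  ∑ (λ _ → 1) ys    ≡⟨ ∑-const 1 ys ⟩
  length ys * 1     ≡⟨ ℕ.*-identityʳ _ ⟩
  length ys         ∎
  where open ≤-Reasoning

length-allFin : ∀ n → length (allFin n) ≡ n
length-allFin n = length-tabulate id

count-filter : ∀ (p : A → Bool) xs → count p xs ≡ length (filter (λ x → p x Bool.≟ true) xs)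
count-filter p []       = refl
count-filter p (x ∷ xs) with p x
... | true  = cong suc (count-filter p xs)
... | false = count-filter p xs

count-≤ : ∀ {p : A → Bool} {xs ys} → Unique xs → (∀ {x} → x ∈ xs → p x ≡ true → x ∈ ys) →
          count p xs ≤ length ys
count-≤ {p = p} {xs} uniq cover = ≤-trans (≤-reflexive (count-filter p xs))
  (length-⊆ (Unique.filter⁺ _ uniq) (λ x∈ → let x∈xs , px = ∈-filter⁻ _ x∈ in cover x∈xs px))

count-≥ : ∀ {p : A → Bool} {xs ys} → Unique ys → (∀ {y} → y ∈ ys → y ∈ xs × p y ≡ true) →
          length ys ≤ count p xs
count-≥ {p = p} {xs} uniq inside = ≤-trans
  (length-⊆ uniq (λ y∈ → let y∈xs , py = inside y∈ in ∈-filter⁺ _ y∈xs py))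
  (≤-reflexive (≡.sym (count-filter p xs)))

-- One of x and y is counted before and only the other one after, while the remaining entries keep
-- their values. The relation between `p x` and `p y` covers both directions of the exchange and
-- excludes x = y.
count-exchange : ∀ {p q : A → Bool} {x y xs} → Unique xs → x ∈ xs → y ∈ xs →
                 p x ≡ not (p y) → q x ≡ not (p x) → q y ≡ not (p y) →
                 (∀ {z} → z ≢ x → z ≢ y → q z ≡ p z) → count q xs ≡ count p xs
count-exchange {p = p} {q} {x} {y} {xs} uniq x∈xs y∈xs px qx qy rest
  with ys , xs↭ ← extract x∈xs
  with ∈-resp-↭ xs↭ y∈xs
... | here refl = contradiction px (b≢not-b (p y))
  where
  b≢not-b : ∀ b → b ≢ not b
  b≢not-b true  ()
  b≢not-b false ()
... | there y∈ys with zs , ys↭ ← extract y∈ys = begin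
  count q xs                          ≡⟨ ∑-↭ _ xs↭zs ⟩
  [ q x ] + ([ q y ] + count q zs)    ≡⟨ cong (λ c → [ q x ] + ([ q y ] + c)) (∑-cong zs (tail (Unique-↭ xs↭zs uniq))) ⟩
  [ q x ] + ([ q y ] + count p zs)    ≡⟨ swapped (p x) (p y) px qx qy ⟩
  [ p x ] + ([ p y ] + count p zs)    ≡⟨ ∑-↭ _ xs↭zs ⟨
  count p xs                          ∎
  where
  open ≡-Reasoning
  xs↭zs = ↭-trans xs↭ (↭-prep x ys↭)
  tail : Unique (x ∷ y ∷ zs) → ∀ {z} → z ∈ zs → [ q z ] ≡ [ p z ]
  tail ((_ ∷ x∉) ∷ y∉ ∷ _) z∈ = cong [_]
    (rest (All.lookup x∉ z∈ ∘ ≡.sym) (All.lookup y∉ z∈ ∘ ≡.sym))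
  swapped : ∀ b c {b′ c′ m} → b ≡ not c → b′ ≡ not b → c′ ≡ not c →
            [ b′ ] + ([ c′ ] + m) ≡ [ b ] + ([ c ] + m)
  swapped true  false refl refl refl = refl
  swapped false true  refl refl refl = refl

-- Degrees inside a vertex set.

degIn : Graph n → List (Fin n) → Fin n → ℕ
degIn G W v = count (adj G v) W

total : Graph n → List (Fin n) → ℕ
total G W = ∑ (degIn G W) W

total-↭ : ∀ (G : Graph n) {W W′} → W ↭ W′ → total G W ≡ total G W′
total-↭ G {W} {W′} p = ≡.trans (∑-↭ (degIn G W) p)
  (∑-cong W′ (λ {v} _ → ∑-↭ (λ u → [ adj G v u ]) p))

-- The vertex v contributes its own row and, by symmetry, an equal column in the rows of W. Its
-- diagonal entry is zero, so its degree can be taken in the longer list.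
total-∷ : ∀ (G : Graph n) v W → total G (v ∷ W) ≡ 2 * degIn G (v ∷ W) v + total G W
total-∷ G v W = begin
  d + ∑ (λ u → [ adj G u v ] + degIn G W u) W    ≡⟨ cong (d +_) (∑-+ _ (degIn G W) W) ⟩
  d + (∑ (λ u → [ adj G u v ]) W + total G W)    ≡⟨ cong (λ s → d + (s + total G W)) column ⟩
  d + (d + total G W)                            ≡⟨ ℕ.+-assoc d d _ ⟨
  d + d + total G W                              ≡⟨ cong (λ s → d + s + total G W) (ℕ.+-identityʳ d) ⟨
  2 * d + total G W                              ∎
  where
  open ≡-Reasoning
  d = degIn G (v ∷ W) v
  column : ∑ (λ u → [ adj G u v ]) W ≡ d
  column = ≡.trans (∑-cong W (λ {u} _ → cong [_] (Graph.sym G u v)))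
                   (cong (λ b → [ b ] + degIn G W v) (≡.sym (irrefl G v)))

-- Degree-preserving 2-switches.

toggle : Bool → Bool → Bool
toggle t b = if t then not b else b

pair : Fin n → Fin n → Fin n → Bool
pair x y z = does (z ≟ x) ∨ does (z ≟ y)

pair-left : ∀ (x y : Fin n) → pair x y x ≡ true
pair-left x y rewrite dec-true (x ≟ x) refl = refl

pair-right : ∀ (x y : Fin n) → pair x y y ≡ true
pair-right x y rewrite dec-true (y ≟ y) refl = ∨-zeroʳ _

pair-other : ∀ {x y z : Fin n} → z ≢ x → z ≢ y → pair x y z ≡ false
pair-other {x = x} {y} {z} z≢x z≢y rewrite dec-false (z ≟ x) z≢x = dec-false (z ≟ y) z≢y

-- An injective naming preserves equality tests, which makes a switch on names agree with the switch
-- on the named vertices.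
pair-injective : ∀ {ρ : Fin k → Fin n} → Injective _≡_ _≡_ ρ →
                 ∀ x y z → pair (ρ x) (ρ y) (ρ z) ≡ pair x y z
pair-injective {ρ = ρ} inj x y z = cong₂ _∨_ (same x) (same y)
  where
  same : ∀ x → does (ρ z ≟ ρ x) ≡ does (z ≟ x)
  same x with z ≟ x
  ... | yes refl = dec-true (ρ z ≟ ρ z) refl
  ... | no  z≢x  = dec-false (ρ z ≟ ρ x) (z≢x ∘ inj)

-- The 4-cycle a b d c, as the complete bipartite graph between {a , d} and {b , c}.  Toggling its edges
-- replaces ab, cd by ac, bd.
cycle : (a b c d : Fin n) → Fin n → Fin n → Bool
cycle a b c d u w = (pair a d u ∧ pair b c w) ∨ (pair b c u ∧ pair a d w)

count-toggle : ∀ {p : Fin n → Bool} {x y W} → Unique W → x ∈ W → y ∈ W → p x ≡ not (p y) →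
               count (λ w → toggle (pair x y w) (p w)) W ≡ count p W
count-toggle {p = p} {x} {y} uniq x∈W y∈W px = count-exchange uniq x∈W y∈W px
  (cong (λ t → toggle t (p x)) (pair-left x y))
  (cong (λ t → toggle t (p y)) (pair-right x y))
  (λ {z} z≢x z≢y → cong (λ t → toggle t (p z)) (pair-other z≢x z≢y))

-- All four vertices are distinct: a missing edge does not separate its ends, hence the two
-- inequalities, and the other four follow from the adjacencies.
record Switchable (G : Graph n) (a b c d : Fin n) : Set where
  field
    ab  : adj G a b ≡ true
    cd  : adj G c d ≡ true
    ac  : adj G a c ≡ false
    bd  : adj G b d ≡ false
    a≢c : a ≢ c
    b≢d : b ≢ d

module Switching {n} (G : Graph n) (a b c d : Fin n) (ok : Switchable G a b c d) where
  open Switchable ok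

  edge⇒≢ : ∀ {u v} → adj G u v ≡ true → u ≢ v
  edge⇒≢ {u} uv refl with () ← ≡.trans (≡.sym uv) (irrefl G u)

  disjoint-ad : ∀ {u} → u ≡ a ⊎ u ≡ d → pair b c u ≡ false
  disjoint-ad (inj₁ refl) = pair-other (edge⇒≢ ab) a≢c
  disjoint-ad (inj₂ refl) = pair-other (b≢d ∘ ≡.sym) (edge⇒≢ cd ∘ ≡.sym)

  split : ∀ u → (u ≡ a ⊎ u ≡ d) ⊎ pair a d u ≡ false
  split u with u ≟ a | u ≟ d
  ... | yes u≡a | _       = inj₁ (inj₁ u≡a)
  ... | no _    | yes u≡d = inj₁ (inj₂ u≡d)
  ... | no _    | no _    = inj₂ refl

  cycle-irrefl : ∀ v → cycle a b c d v v ≡ false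
  cycle-irrefl v with split v
  ... | inj₁ v∈ad rewrite disjoint-ad v∈ad | ∧-zeroʳ (pair a d v) = refl
  ... | inj₂ v∉ad rewrite v∉ad = ∧-zeroʳ (pair b c v)

  switched : Graph n
  switched = record
    { adj    = λ u w → toggle (cycle a b c d u w) (adj G u w)
    ; sym    = λ u w → cong₂ toggle
        (≡.trans (∨-comm (pair a d u ∧ pair b c w) _)
                 (cong₂ _∨_ (∧-comm (pair b c u) _) (∧-comm (pair a d u) _)))
        (Graph.sym G u w)
    ; irrefl = λ v → cong₂ toggle (cycle-irrefl v) (irrefl G v)
    }

  -- Each of a, b, c, d loses one edge and gains one; other rows do not change. With W a core this
  -- preserves the core, and with W the whole vertex set it preserves the degree sequence.
  degIn-switched : ∀ {W} → Unique W → a ∈ W → b ∈ W → c ∈ W → d ∈ W →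
                   ∀ u → degIn switched W u ≡ degIn G W u
  degIn-switched {W} uniq a∈ b∈ c∈ d∈ u = go (u ≟ a) (u ≟ b) (u ≟ c) (u ≟ d)
    where
    edge : ∀ {u v} → adj G u v ≡ true → adj G v u ≡ true
    edge uv = ≡.trans (Graph.sym G _ _) uv
    nonedge : ∀ {u v} → adj G u v ≡ false → adj G v u ≡ false
    nonedge uv = ≡.trans (Graph.sym G _ _) uv
    opposite : ∀ {x y z} → adj G u x ≡ z → adj G u y ≡ not z → adj G u x ≡ not (adj G u y)
    opposite {z = true}  ux uy = ≡.trans ux (≡.sym (cong not uy))
    opposite {z = false} ux uy = ≡.trans ux (≡.sym (cong not uy))
    along : ∀ {x y z} → x ∈ W → y ∈ W → adj G u x ≡ z → adj G u y ≡ not z →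
            (∀ w → cycle a b c d u w ≡ pair x y w) → degIn switched W u ≡ degIn G W u
    along x∈ y∈ ux uy row = ≡.trans
      (∑-cong W λ {w} _ → cong (λ t → [ toggle t (adj G u w) ]) (row w))
      (count-toggle uniq x∈ y∈ (opposite ux uy))
    row-ad : u ≡ a ⊎ u ≡ d → ∀ w → cycle a b c d u w ≡ pair b c w
    row-ad (inj₁ refl) w rewrite pair-left a d  | disjoint-ad (inj₁ (refl {x = a})) = ∨-identityʳ _
    row-ad (inj₂ refl) w rewrite pair-right a d | disjoint-ad (inj₂ (refl {x = d})) = ∨-identityʳ _
    row-bc : pair b c u ≡ true → pair a d u ≡ false → ∀ w → cycle a b c d u w ≡ pair a d w
    row-bc bc ad w rewrite bc | ad = refl
    go : Dec (u ≡ a) → Dec (u ≡ b) → Dec (u ≡ c) → Dec (u ≡ d) →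
         degIn switched W u ≡ degIn G W u
    go (yes refl) _ _ _ = along b∈ c∈ ab ac (row-ad (inj₁ refl))
    go _ _ _ (yes refl) = along b∈ c∈ (nonedge bd) (edge cd) (row-ad (inj₂ refl))
    go (no u≢a) (yes refl) _ (no u≢d) =
      along a∈ d∈ (edge ab) bd (row-bc (pair-left b c) (pair-other u≢a u≢d))
    go (no u≢a) _ (yes refl) (no u≢d) =
      along a∈ d∈ (nonedge ac) cd (row-bc (pair-right b c) (pair-other u≢a u≢d))
    go (no u≢a) (no u≢b) (no u≢c) (no u≢d) = ∑-cong W λ {w} _ → cong (λ t → [ toggle t (adj G u w) ]) (none w)
      where
      none : ∀ w → cycle a b c d u w ≡ false
      none w rewrite pair-other {x = a} {d} u≢a u≢d | pair-other {x = b} {c} u≢b u≢c = refl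

-- The goal up to switching, dense sets and cores.

Target : Graph n → Set
Target {n} G = Σ (Graph n) λ G′ → (∀ v → deg G′ v ≡ deg G v) × Contains G′ K5-P3

-- `size` is the bound 4 |W| - 4 on the degree sum, rearranged to avoid truncated subtraction.
record Dense (G : Graph n) (W : List (Fin n)) : Set where
  field
    unique : Unique W
    size   : 4 * length W ≤ 4 + total G W

record Core (G : Graph n) (W : List (Fin n)) : Set where
  field
    dense     : Dense G W
    minDegree : ∀ {v} → v ∈ W → 3 ≤ degIn G W v
  open Dense dense public

-- Named vertices and partial knowledge of their adjacency.

Fact : ℕ → Set
Fact k = Fin k × Fin k × Bool

Holds : Graph n → (Fin k → Fin n) → Fact k → Set
Holds G ρ (i , j , b) = adj G (ρ i) (ρ j) ≡ b

record Model (G : Graph n) (W : List (Fin n)) (F : List (Fact k)) (ρ : Fin k → Fin n) : Set where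
  field
    injective : Injective _≡_ _≡_ ρ
    inside    : ∀ i → ρ i ∈ W
    holds     : All (Holds G ρ) F
open Model

-- Quantified over all graphs and namings, so that a settled configuration can be reused under a
-- renaming and after the graph has been switched.
Forces : List (Fact k) → Set
Forces {k} F = ∀ {n} {G : Graph n} {W} {ρ : Fin k → Fin n} → Core G W → Model G W F ρ → Target G

Known : List (Fact k) → Fin k → Fin k → Bool → Set
Known F i j b = (i , j , b) ∈ F ⊎ (j , i , b) ∈ F

known? : ∀ (F : List (Fact k)) i j b → Dec (Known F i j b)
known? F i j b = ((i , j , b) ∈? F) ⊎-dec ((j , i , b) ∈? F)
  where open import Data.List.Membership.DecPropositional (≡-dec _≟_ (≡-dec _≟_ Bool._≟_)) using (_∈?_)

known : ∀ {G : Graph n} {W F} {ρ : Fin k → Fin n} → Model G W F ρ →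
        ∀ {i j b} → Known F i j b → adj G (ρ i) (ρ j) ≡ b
known         M (inj₁ ij∈F) = All.lookup (holds M) ij∈F
known {G = G} M (inj₂ ji∈F) = ≡.trans (Graph.sym G _ _) (All.lookup (holds M) ji∈F)

learn : ∀ {G : Graph n} {W F} {ρ : Fin k → Fin n} → Model G W F ρ →
        ∀ {i j b} → adj G (ρ i) (ρ j) ≡ b → Model G W ((i , j , b) ∷ F) ρ
learn M ij = record { injective = injective M ; inside = inside M ; holds = ij ∷ holds M }

NonNeighbour : List (Fact k) → Fin k → Fin k → Set
NonNeighbour F i j = j ≡ i ⊎ Known F i j false

-- A pair of unknown status counts as a possible edge, so the length bounds the degree of i among
-- the named vertices from above.
candidates : List (Fact k) → Fin k → List (Fin k)
candidates F i = filter (λ j → ¬? ((j ≟ i) ⊎-dec known? F i j false)) (allFin _)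

adjacent⇒candidate : ∀ {G : Graph n} {W F} {ρ : Fin k → Fin n} → Model G W F ρ →
                     ∀ {i j} → adj G (ρ i) (ρ j) ≡ true → j ∈ candidates F i
adjacent⇒candidate {G = G} {F = F} {ρ} M {i} {j} ij = ∈-filter⁺ _ (∈-allFin j) ¬non
  where
  ¬non : ¬ NonNeighbour F i j
  ¬non (inj₁ refl) with () ← ≡.trans (≡.sym ij) (irrefl G (ρ i))
  ¬non (inj₂ kn)   with () ← ≡.trans (≡.sym ij) (known {G = G} M kn)

infixr 5 _◂_
_◂_ : A → (Fin k → A) → Fin (suc k) → A
(x ◂ ρ) zero    = x
(x ◂ ρ) (suc i) = ρ i

weaken : List (Fact k) → List (Fact (suc k))
weaken = map λ (i , j , b) → suc i , suc j , b

extend : ∀ {G : Graph n} {W F w} {ρ : Fin k → Fin n} → Model G W F ρ →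
         w ∈ W → ¬ (∃ λ i → ρ i ≡ w) → Model G W (weaken F) (w ◂ ρ)
extend {w = w} {ρ} M w∈W w∉ρ = record
  { injective = inj _ _
  ; inside    = λ { zero → w∈W ; (suc i) → inside M i }
  ; holds     = All.map⁺ (holds M)
  }
  where
  inj : ∀ i j → (w ◂ ρ) i ≡ (w ◂ ρ) j → i ≡ j
  inj zero    zero    _  = refl
  inj zero    (suc j) eq = contradiction (j , ≡.sym eq) w∉ρ
  inj (suc i) zero    eq = contradiction (i , eq) w∉ρ
  inj (suc i) (suc j) eq = cong suc (injective M eq)

newVertex? : ∀ (ρ : Fin k → Fin n) (p : Fin n → Bool) W →
             (∃ λ w → w ∈ W × p w ≡ true × ¬ (∃ λ i → ρ i ≡ w)) ⊎
             (∀ {w} → w ∈ W → p w ≡ true → ∃ λ i → ρ i ≡ w)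
newVertex? ρ p W with Any.any? (λ w → (p w Bool.≟ true) ×-dec ¬? (Fin.any? (λ i → ρ i ≟ w))) W
... | yes new = inj₁ (find new)
... | no ¬new = inj₂ λ {w} w∈W pw →
  decidable-stable (Fin.any? (λ i → ρ i ≟ w)) (λ ∉ρ → ¬new (lose w∈W (pw , ∉ρ)))

degIn-≤-candidates : ∀ {G : Graph n} {W F} {ρ : Fin k → Fin n} → Unique W → Model G W F ρ → ∀ i →
                     (∀ {w} → w ∈ W → adj G (ρ i) w ≡ true → ∃ λ j → ρ j ≡ w) →
                     degIn G W (ρ i) ≤ length (candidates F i)
degIn-≤-candidates {G = G} {W} {F} {ρ} uniq M i old = ≤-trans (count-≤ uniq cover)
  (≤-reflexive (length-map ρ (candidates F i)))
  where
  cover : ∀ {w} → w ∈ W → adj G (ρ i) w ≡ true → w ∈ map ρ (candidates F i)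
  cover w∈W iw with j , refl ← old w∈W iw = ∈-map⁺ ρ (adjacent⇒candidate {G = G} M iw)

-- If all its neighbours in W were named, they would lie among the candidates, which are too few.
-- The new vertex takes the name `zero` and shifts the older names.
newNeighbour : ∀ {G : Graph n} {W F} {ρ : Fin k → Fin n} → Unique W → Model G W F ρ → ∀ i →
               length (candidates F i) < degIn G W (ρ i) →
               ∃ λ w → Model G W ((zero , suc i , true) ∷ weaken F) (w ◂ ρ)
newNeighbour {G = G} {W} {ρ = ρ} uniq M i few with newVertex? ρ (adj G (ρ i)) W
... | inj₁ (w , w∈W , iw , w∉ρ) = w , learn {G = G} (extend {G = G} M w∈W w∉ρ) (≡.trans (Graph.sym G _ _) iw)
... | inj₂ old = contradiction (degIn-≤-candidates {G = G} uniq M i old) (ℕ.<⇒≱ few)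

image : (Fin k → A) → List A
image ρ = map ρ (allFin _)

length-image : ∀ (ρ : Fin k → A) → length (image ρ) ≡ k
length-image ρ = ≡.trans (length-map ρ (allFin _)) (length-allFin _)

image-⊆ : ∀ {G : Graph n} {W F} {ρ : Fin k → Fin n} → Model G W F ρ → image ρ ⊆ W
image-⊆ {ρ = ρ} M v∈ with i , _ , refl ← ∈-map⁻ ρ v∈ = inside M i

⊆-image : ∀ {W} {ρ : Fin k → A} → (∀ {w} → w ∈ W → ∃ λ i → ρ i ≡ w) → W ⊆ image ρ
⊆-image {ρ = ρ} old w∈W with i , refl ← old w∈W = ∈-map⁺ ρ (∈-allFin i)

Model-≤ : ∀ {G : Graph n} {W F} {ρ : Fin k → Fin n} → Model G W F ρ → k ≤ length W
Model-≤ {G = G} {ρ = ρ} M = ≤-trans (≤-reflexive (≡.sym (length-image ρ)))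
  (length-⊆ (Unique.map⁺ (injective M) (Unique.allFin⁺ _)) (image-⊆ {G = G} M))

anotherMember : ∀ (ρ : Fin k → Fin n) {W} → Unique W → k < length W →
                ∃ λ w → w ∈ W × ¬ (∃ λ i → ρ i ≡ w)
anotherMember ρ {W} uniq k<W with newVertex? ρ (λ _ → true) W
... | inj₁ (w , w∈W , _ , w∉ρ) = w , w∈W , w∉ρ
... | inj₂ old = contradiction
  (≤-trans (length-⊆ uniq (⊆-image λ w∈W → old w∈W refl)) (≤-reflexive (length-image ρ)))
  (ℕ.<⇒≱ k<W)

-- Otherwise all of W is named, each degree is at most a candidate count, and the sum of these falls
-- below what density asks of k vertices.
newMember : ∀ {G : Graph n} {W F} {ρ : Fin k → Fin n} → Dense G W → Model G W F ρ →
            4 + ∑ (λ i → length (candidates F i)) (allFin k) < 4 * k →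
            ∃ λ w → w ∈ W × ¬ (∃ λ i → ρ i ≡ w)
newMember {k = k} {G = G} {W} {F} {ρ} dense M few with newVertex? ρ (λ _ → true) W
... | inj₁ (w , w∈W , _ , w∉ρ) = w , w∈W , w∉ρ
... | inj₂ old = contradiction few (ℕ.≤⇒≯ (begin
  4 * k                                               ≤⟨ ℕ.*-monoʳ-≤ 4 (Model-≤ {G = G} M) ⟩
  4 * length W                                        ≤⟨ Dense.size dense ⟩
  4 + total G W                                       ≤⟨ ℕ.+-monoʳ-≤ 4 (∑-⊆ (degIn G W) uniq (⊆-image λ w∈W → old w∈W refl)) ⟩
  4 + ∑ (degIn G W) (image ρ)                         ≡⟨ cong (λ xs → 4 + sum xs) (map-∘ (allFin k)) ⟨
  4 + ∑ (degIn G W ∘ ρ) (allFin k)                    ≤⟨ ℕ.+-monoʳ-≤ 4 (∑-mono (allFin k) λ {i} _ →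
                                                           degIn-≤-candidates {G = G} uniq M i (λ w∈W _ → old w∈W refl)) ⟩
  4 + ∑ (λ i → length (candidates F i)) (allFin k)    ∎))
  where
  open ≤-Reasoning
  uniq = Dense.unique dense

-- Switches on known facts, and decision trees.

toggleFact : (a b c d : Fin k) → Fact k → Fact k
toggleFact a b c d (i , j , v) = i , j , toggle (cycle a b c d i j) v

switchFacts? : ∀ (F : List (Fact k)) a b c d →
  Dec (Known F a b true × Known F c d true × Known F a c false × Known F b d false × a ≢ c × b ≢ d)
switchFacts? F a b c d =
  known? F a b true ×-dec known? F c d true ×-dec known? F a c false ×-dec known? F b d false ×-dec
  ¬? (a ≟ c) ×-dec ¬? (b ≟ d)

switch-preserves : ∀ {G : Graph n} {W a b c d} (ok : Switchable G a b c d) →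
                   a ∈ W → b ∈ W → c ∈ W → d ∈ W →
                   Core G W → Core (Switching.switched G a b c d ok) W
switch-preserves {G = G} {W} {a} {b} {c} {d} ok a∈ b∈ c∈ d∈ core = record
  { dense = record
    { unique = Core.unique core
    ; size   = subst (λ t → 4 * length W ≤ 4 + t) (≡.sym (∑-cong W λ {v} _ → same v)) (Core.size core)
    }
  ; minDegree = λ {v} v∈W → subst (3 ≤_) (≡.sym (same v)) (Core.minDegree core v∈W)
  }
  where same = Switching.degIn-switched G a b c d ok (Core.unique core) a∈ b∈ c∈ d∈

Transports : List (Fact k) → (Fin k → Fin n) → List (Fact n) → Set
Transports F′ θ F = All (λ (i , j , b) → Known F (θ i) (θ j) b) F′

transports? : ∀ (F′ : List (Fact k)) (θ : Fin k → Fin n) F → Dec (Transports F′ θ F)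
transports? F′ θ F = All.all? (λ (i , j , b) → known? F (θ i) (θ j) b) F′

-- A decision tree for the existence of a K5 - P3 up to switching.  In the scope of F there are k named
-- vertices of the core, numbered from the most recent one, and F is what is known about their adjacency.
-- A vertex with fewer than 3 candidate neighbours among the named ones has a new neighbour (fresh); if
-- the candidate edges are too few for the size condition of a dense set, there is a new vertex (extra).
data Plan : List (Fact k) → Set where
  use    : ∀ {m} {F′ : List (Fact m)} {F : List (Fact k)} → Forces F′ → (θ : Vec (Fin k) m) →
           {distinct : True (Vec.allPairs? (λ i j → ¬? (i ≟ j)) θ)} →
           {transported : True (transports? F′ (Vec.lookup θ) F)} → Plan F
  query  : ∀ {F : List (Fact k)} i j → Plan ((i , j , true) ∷ F) → Plan ((i , j , false) ∷ F) → Plan F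
  fresh  : ∀ {F : List (Fact k)} i → {few : True (length (candidates F i) <? 3)} →
           Plan ((zero , suc i , true) ∷ weaken F) → Plan F
  extra  : ∀ {F : List (Fact k)} → {few : True (4 + ∑ (λ i → length (candidates F i)) (allFin k) <? 4 * k)} →
           Plan (weaken F) → Plan F
  switch : ∀ {F : List (Fact k)} a b c d → {legal : True (switchFacts? F a b c d)} →
           Plan (map (toggleFact a b c d) F) → Plan F

-- Soundness, by induction on the tree: a node refers to a settled configuration, adds a fact, names
-- a further vertex or replaces the graph by a switched one.
forces : ∀ {F : List (Fact k)} → Plan F → Forces F
forces (use F′⇒ θ {distinct = distinct} {transported = transported}) {G = G} core M = F′⇒ core record
  { injective = lookup-injective (toWitness distinct) _ _ ∘ injective M
  ; inside    = inside M ∘ Vec.lookup θ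
  ; holds     = All.map (λ kn → known {G = G} M kn) (toWitness transported)
  }
forces (query i j p q) {G = G} {ρ = ρ} core M with adj G (ρ i) (ρ j) in ij
... | true  = forces p core (learn {G = G} M ij)
... | false = forces q core (learn {G = G} M ij)
forces (fresh i {few = few} p) {G = G} core M =
  let w , M′ = newNeighbour {G = G} (Core.unique core) M i
                 (≤-trans (toWitness few) (Core.minDegree core (inside M i)))
  in forces p core M′
forces (extra {few = few} p) {G = G} core M =
  let w , w∈W , w∉ρ = newMember {G = G} (Core.dense core) M (toWitness few)
  in forces p core (extend {G = G} M w∈W w∉ρ)
forces (switch a b c d {legal = legal} p) {G = G} {ρ = ρ} core M
  with ab , cd , ac , bd , a≢c , b≢d ← toWitness legal =
  -- W is still a core of the switched graph, and the degrees found there are those of `G`.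
  let G″ , same , G″∋ = forces p (switch-preserves ok (inside M a) (inside M b) (inside M c) (inside M d) core)
        record { injective = injective M
               ; inside    = inside M
               ; holds     = All.map⁺ (All.map (λ {f} → toggled f) (holds M)) }
  in G″ , (λ v → ≡.trans (same v) (degree v)) , G″∋
  where
  ok : Switchable G (ρ a) (ρ b) (ρ c) (ρ d)
  ok = record
    { ab  = known {G = G} M ab
    ; cd  = known {G = G} M cd
    ; ac  = known {G = G} M ac
    ; bd  = known {G = G} M bd
    ; a≢c = a≢c ∘ injective M
    ; b≢d = b≢d ∘ injective M
    }
  open Switching G (ρ a) (ρ b) (ρ c) (ρ d) ok
  degree : ∀ v → deg switched v ≡ deg G v
  degree = degIn-switched (Unique.allFin⁺ _) (∈-allFin _) (∈-allFin _) (∈-allFin _) (∈-allFin _)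
  toggled : ∀ f → Holds G ρ f → Holds switched ρ (toggleFact a b c d f)
  toggled (i , j , v) ij = cong₂ toggle
    (cong₂ _∨_ (cong₂ _∧_ (at a d i) (at b c j)) (cong₂ _∧_ (at b c i) (at a d j))) ij
    where at = pair-injective (injective M)

-- Configurations around a vertex of degree at least 4.

-- The plans were found by computer search; each may end in a configuration settled before it.
module Configurations where

  open import Agda.Builtin.FromNat using (Number; fromNat)
  open import Data.Unit using (tt)
  import Data.Fin.Literals as Fin
  import Data.Nat.Literals as ℕ

  instance
    ℕ-literals : Number ℕ
    ℕ-literals = ℕ.number
    Fin-literals : Number (Fin n)
    Fin-literals {n} = Fin.number n

  -- Vertex 4 is adjacent to 0, 1, 2, 3. The names tell the known edges among these four: in order,
  -- none, a path on four vertices, a path on three, two disjoint edges, a single edge.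
  hub gem path matching edge : List (Fact 5)
  hub      = (0 , 4 , true) ∷ (1 , 4 , true) ∷ (2 , 4 , true) ∷ (3 , 4 , true) ∷ []
  gem      = (3 , 2 , true) ∷ (2 , 1 , true) ∷ (1 , 0 , true) ∷ hub
  path     = (3 , 2 , true) ∷ (2 , 1 , true) ∷ hub
  matching = (3 , 2 , true) ∷ (1 , 0 , true) ∷ hub
  edge     = (3 , 2 , true) ∷ hub

  -- Vertices 0 .. 4 of K5 - P3: the complement of the path 0 1 2 3 is the path 2 0 3 1.
  placement : Vec (Fin 5) 5
  placement = 1 ∷ 3 ∷ 0 ∷ 2 ∷ 4 ∷ []

  gem-contains : ∀ {G : Graph n} {W} {ρ : Fin 5 → Fin n} → Model G W gem ρ → Contains G K5-P3
  gem-contains {G = G} {ρ = ρ} M = ρ ∘ Vec.lookup placement , (λ {i} {j} → distinct i j ∘ injective M) ,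
    λ i j ij → known {G = G} M (edges i j ij)
    where
    distinct : ∀ i j → Vec.lookup placement i ≡ Vec.lookup placement j → i ≡ j
    distinct = from-yes (Fin.all? λ i → Fin.all? λ j →
      (Vec.lookup placement i ≟ Vec.lookup placement j) →-dec (i ≟ j))
    edges : ∀ i j → K5-P3-adj i j ≡ true → Known gem (Vec.lookup placement i) (Vec.lookup placement j) true
    edges = from-yes (Fin.all? λ i → Fin.all? λ j →
      (K5-P3-adj i j Bool.≟ true) →-dec known? gem (Vec.lookup placement i) (Vec.lookup placement j) true)

  gem-forces : Forces gem
  gem-forces {G = G} core M = G , (λ v → refl) , gem-contains M

  -- An edge from 0 to an end of the path 3 2 1 completes a gem. Otherwise either 3 1 closes a
  -- triangle, or both ends of the path receive new neighbours.
  path-forces : Forces path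
  path-forces = forces $
    query 1 0 (use gem-forces (0 ∷ 1 ∷ 2 ∷ 3 ∷ 4 ∷ [])) $
    query 3 0 (use gem-forces (1 ∷ 2 ∷ 3 ∷ 0 ∷ 4 ∷ [])) $
    query 3 1
      (query 2 0 (use gem-forces (0 ∷ 2 ∷ 3 ∷ 1 ∷ 4 ∷ [])) $
       fresh 0 $
       query 4 0
         (query 3 0 (use gem-forces (0 ∷ 3 ∷ 5 ∷ 2 ∷ 4 ∷ [])) $
          switch 4 3 1 0 $ use gem-forces (3 ∷ 2 ∷ 4 ∷ 1 ∷ 5 ∷ [])) $
       switch 4 3 0 1 $ use gem-forces (4 ∷ 2 ∷ 3 ∷ 1 ∷ 5 ∷ [])) $
    fresh 3 $
    query 5 0 (use gem-forces (2 ∷ 3 ∷ 4 ∷ 0 ∷ 5 ∷ [])) $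
    query 3 0 (use gem-forces (0 ∷ 4 ∷ 5 ∷ 2 ∷ 3 ∷ [])) $
    query 2 0 (switch 5 1 0 4 $ use gem-forces (0 ∷ 2 ∷ 3 ∷ 4 ∷ 5 ∷ [])) $
    query 3 1 (switch 5 2 0 4 $ use gem-forces (2 ∷ 4 ∷ 5 ∷ 1 ∷ 3 ∷ [])) $
    fresh 2 $
    query 4 0 (use gem-forces (0 ∷ 3 ∷ 6 ∷ 5 ∷ 4 ∷ [])) $
    query 6 0 (use gem-forces (0 ∷ 3 ∷ 4 ∷ 5 ∷ 6 ∷ [])) $
    query 5 0 (switch 6 3 1 5 $ use gem-forces (0 ∷ 3 ∷ 4 ∷ 6 ∷ 5 ∷ [])) $
    query 2 0
      (query 1 0
         (query 2 1
            -- All adjacencies among the seven named vertices are known here, and the degrees are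
            -- (4, 3, 3, 3, 3, 3, 3). Their sum 22 is less than 4 * 7 - 4, so there is an eighth
            -- vertex.
            (extra $
             query 0 3
               (query 2 0 (switch 7 6 1 4 $ use gem-forces (7 ∷ 1 ∷ 2 ∷ 0 ∷ 3 ∷ [])) $
                switch 6 2 3 0 $ use gem-forces (4 ∷ 5 ∷ 6 ∷ 3 ∷ 7 ∷ [])) $
             query 1 0 (switch 7 3 1 0 $ use gem-forces (1 ∷ 4 ∷ 5 ∷ 6 ∷ 7 ∷ [])) $
             query 5 0 (switch 5 0 2 3 $ use gem-forces (2 ∷ 6 ∷ 7 ∷ 4 ∷ 5 ∷ [])) $
             query 6 0 (switch 6 0 3 1 $ use gem-forces (4 ∷ 5 ∷ 6 ∷ 3 ∷ 7 ∷ [])) $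
             query 2 0 (switch 7 5 2 0 $ use gem-forces (1 ∷ 3 ∷ 7 ∷ 6 ∷ 2 ∷ [])) $
             query 4 0 (switch 4 0 3 2 $ use gem-forces (3 ∷ 4 ∷ 5 ∷ 6 ∷ 7 ∷ [])) $
             query 7 0 (switch 7 0 2 3 $ use gem-forces (4 ∷ 5 ∷ 6 ∷ 2 ∷ 7 ∷ [])) $
             -- The eighth vertex is adjacent to none of the other seven, so its neighbour is a
             -- ninth one, and the edge between these two is available for switches.
             fresh 0 $
             query 5 0
               (query 8 0 (use gem-forces (0 ∷ 5 ∷ 6 ∷ 7 ∷ 8 ∷ [])) $
                switch 8 4 0 1 $ use gem-forces (0 ∷ 5 ∷ 6 ∷ 7 ∷ 8 ∷ [])) $
             switch 8 5 1 0 $ switch 8 1 3 2 $ use gem-forces (4 ∷ 3 ∷ 7 ∷ 6 ∷ 8 ∷ [])) $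
          switch 6 2 0 1 $ use gem-forces (0 ∷ 3 ∷ 4 ∷ 5 ∷ 6 ∷ [])) $
       switch 5 1 2 0 $ use gem-forces (3 ∷ 4 ∷ 5 ∷ 2 ∷ 6 ∷ [])) $
    query 1 0 (switch 6 2 1 0 $ use gem-forces (3 ∷ 4 ∷ 5 ∷ 1 ∷ 6 ∷ [])) $
    fresh 0 $
    query 3 0
      (query 2 0
         (query 4 0
            (query 7 0 (use gem-forces (0 ∷ 4 ∷ 5 ∷ 6 ∷ 7 ∷ [])) $
             switch 7 6 0 3 $ use gem-forces (1 ∷ 0 ∷ 7 ∷ 5 ∷ 4 ∷ [])) $
          switch 7 4 2 0 $ switch 7 3 4 1 $ use gem-forces (4 ∷ 5 ∷ 6 ∷ 2 ∷ 7 ∷ [])) $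
       switch 6 2 3 0 $ use gem-forces (4 ∷ 5 ∷ 6 ∷ 3 ∷ 7 ∷ [])) $
    switch 7 3 1 0 $ use gem-forces (1 ∷ 4 ∷ 5 ∷ 6 ∷ 7 ∷ [])

  -- An edge between the two matching edges gives a path on all four neighbours. If the queried ones
  -- are absent, a new neighbour of 1 yields a path on three, at once if it is adjacent to the hub
  -- and after switches if not.
  matching-forces : Forces matching
  matching-forces = forces $
    query 2 0 (use gem-forces (1 ∷ 0 ∷ 2 ∷ 3 ∷ 4 ∷ [])) $
    query 3 1 (use gem-forces (0 ∷ 1 ∷ 3 ∷ 2 ∷ 4 ∷ [])) $
    query 2 1 (use gem-forces (0 ∷ 1 ∷ 2 ∷ 3 ∷ 4 ∷ [])) $
    fresh 1 $
    query 5 0 (use path-forces (4 ∷ 0 ∷ 2 ∷ 1 ∷ 5 ∷ [])) $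
    query 4 0 (switch 5 4 0 2 $ switch 5 1 4 3 $ use path-forces (3 ∷ 0 ∷ 4 ∷ 2 ∷ 5 ∷ [])) $
    switch 4 3 0 2 $ use path-forces (4 ∷ 1 ∷ 2 ∷ 3 ∷ 5 ∷ [])

  -- A second edge among the neighbours makes a path or a matching. If the queried ones are absent,
  -- a new neighbour of 1, and if necessary one of 2, leads to such a configuration.
  edge-forces : Forces edge
  edge-forces = forces $
    query 2 0 (use path-forces (1 ∷ 0 ∷ 2 ∷ 3 ∷ 4 ∷ [])) $
    query 2 1 (use path-forces (0 ∷ 1 ∷ 2 ∷ 3 ∷ 4 ∷ [])) $
    query 3 1 (use path-forces (0 ∷ 1 ∷ 3 ∷ 2 ∷ 4 ∷ [])) $
    query 1 0 (use matching-forces (0 ∷ 1 ∷ 2 ∷ 3 ∷ 4 ∷ [])) $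
    fresh 1 $
    query 5 0 (use matching-forces (0 ∷ 2 ∷ 3 ∷ 4 ∷ 5 ∷ [])) $
    query 3 0 (switch 5 1 0 3 $ use matching-forces (0 ∷ 2 ∷ 3 ∷ 4 ∷ 5 ∷ [])) $
    fresh 3 $
    query 6 0 (use path-forces (3 ∷ 0 ∷ 4 ∷ 5 ∷ 6 ∷ [])) $
    query 2 0 (switch 6 3 0 4 $ use matching-forces (0 ∷ 2 ∷ 4 ∷ 5 ∷ 6 ∷ [])) $
    switch 6 4 1 3 $ switch 6 2 4 0 $ use path-forces (1 ∷ 3 ∷ 4 ∷ 5 ∷ 6 ∷ [])

  -- One edge among the neighbours suffices. If the queried pairs have none, new neighbours of 0,
  -- and if necessary of 3, give one directly or after switches.
  hub-forces : Forces hub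
  hub-forces = forces $
    query 3 2 (use edge-forces (0 ∷ 1 ∷ 2 ∷ 3 ∷ 4 ∷ [])) $
    query 3 0 (use edge-forces (1 ∷ 2 ∷ 0 ∷ 3 ∷ 4 ∷ [])) $
    query 2 0 (use edge-forces (1 ∷ 3 ∷ 0 ∷ 2 ∷ 4 ∷ [])) $
    query 1 0 (use edge-forces (2 ∷ 3 ∷ 0 ∷ 1 ∷ 4 ∷ [])) $
    query 3 1 (use edge-forces (0 ∷ 2 ∷ 1 ∷ 3 ∷ 4 ∷ [])) $
    fresh 0 $
    query 5 0 (use edge-forces (3 ∷ 4 ∷ 0 ∷ 1 ∷ 5 ∷ [])) $
    query 3 0 (switch 5 4 0 3 $ use edge-forces (2 ∷ 3 ∷ 0 ∷ 1 ∷ 5 ∷ [])) $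
    query 4 0 (switch 5 3 0 4 $ use edge-forces (2 ∷ 4 ∷ 0 ∷ 1 ∷ 5 ∷ [])) $
    fresh 4 $
    query 6 0 (use edge-forces (3 ∷ 4 ∷ 0 ∷ 5 ∷ 6 ∷ [])) $
    switch 6 4 0 5 $ switch 5 4 2 1 $ use edge-forces (0 ∷ 3 ∷ 2 ∷ 5 ∷ 6 ∷ [])

open Configurations using (gem; gem-contains; hub-forces)

-- From dense sets to a gem, by deleting vertices of small degree.

point : ∀ {G : Graph n} {W v} → v ∈ W → Model {k = 1} G W [] (λ _ → v)
point v∈W = record { injective = λ { {zero} {zero} _ → refl } ; inside = λ _ → v∈W ; holds = [] }

-- If all degrees were at most 3, density would give 4 |W| <= 4 + 3 |W|, hence |W| <= 4.
highDegree : ∀ {G : Graph n} {W} → Dense G W → 5 ≤ length W → ∃ λ v → v ∈ W × 4 ≤ degIn G W v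
highDegree {G = G} {W} dense 5≤W with Any.any? (λ v → 4 ≤? degIn G W v) W
... | yes v = find v
... | no ¬v = contradiction (ℕ.+-cancelʳ-≤ (length W * 3) (length W) 4 (begin
  length W + length W * 3  ≡⟨ ℕ.*-suc (length W) 3 ⟨
  length W * 4             ≡⟨ ℕ.*-comm (length W) 4 ⟩
  4 * length W             ≤⟨ Dense.size dense ⟩
  4 + total G W            ≤⟨ ℕ.+-monoʳ-≤ 4 (∑-mono W λ v∈W → ℕ.≤-pred (ℕ.≰⇒> (¬v ∘ lose v∈W))) ⟩
  4 + ∑ (λ _ → 3) W        ≡⟨ cong (4 +_) (∑-const 3 W) ⟩
  4 + length W * 3         ∎)) (ℕ.<⇒≱ 5≤W)
  where open ≤-Reasoning

core⇒target : ∀ {G : Graph n} {W} → Core G W → 5 ≤ length W → Target G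
core⇒target {G = G} core 5≤W =
  let v , v∈W , 4≤d = highDegree {G = G} dense 5≤W
      -- The centre is always the oldest name: among k names it has index k - 1 and k - 1
      -- candidates, fewer than 4 in all four steps. The facts collected are exactly `hub`.
      _ , M₁ = newNeighbour {G = G} unique (point {G = G} v∈W) (# 0) (≤-trans (from-yes (1 ≤? 4)) 4≤d)
      _ , M₂ = newNeighbour {G = G} unique M₁ (# 1) (≤-trans (from-yes (2 ≤? 4)) 4≤d)
      _ , M₃ = newNeighbour {G = G} unique M₂ (# 2) (≤-trans (from-yes (3 ≤? 4)) 4≤d)
      _ , M₄ = newNeighbour {G = G} unique M₃ (# 3) 4≤d
  in hub-forces core M₄
  where open Core core

degIn-< : ∀ {G : Graph n} {W v} → Unique W → v ∈ W → degIn G W v < length W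
degIn-< {G = G} {W} {v} uniq v∈W with ys , W↭ ← extract v∈W =
  ≤-trans (s≤s (count-≤ uniq cover)) (≤-reflexive (≡.sym (↭-length W↭)))
  where
  cover : ∀ {w} → w ∈ W → adj G v w ≡ true → w ∈ ys
  cover w∈W vw with ∈-resp-↭ W↭ w∈W
  ... | there w∈ys = w∈ys
  ... | here refl with () ← ≡.trans (≡.sym vw) (irrefl G v)

-- Around a nonadjacent pair the size condition would force a fifth vertex.
four-complete : ∀ {G : Graph n} {W} → Dense G W → length W ≡ 4 →
                ∀ {x y} → x ∈ W → y ∈ W → x ≢ y → adj G x y ≡ true
four-complete {G = G} {W} dense W≡4 {x} {y} x∈W y∈W x≢y with adj G x y in xy
... | true  = refl
... | false = contradiction (subst (5 ≤_) W≡4 (Model-≤ {G = G} M₅)) (ℕ.<⇒≱ ≤-refl)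
  where
  grow : ∀ {k} {F : List (Fact k)} {ρ} → Model G W F ρ →
         {True (4 + ∑ (λ i → length (candidates F i)) (allFin k) <? 4 * k)} →
         Σ (Fin (suc k) → Fin _) (Model G W (weaken F))
  grow M {few} = let w , w∈W , w∉ρ = newMember {G = G} dense M (toWitness few)
                 in w ◂ _ , extend {G = G} M w∈W w∉ρ
  M₂ : Model G W ((# 0 , # 1 , false) ∷ []) (x ◂ λ _ → y)
  M₂ = learn {G = G} (extend {G = G} (point {G = G} y∈W) x∈W λ (_ , y≡x) → x≢y (≡.sym y≡x)) xy
  -- With one nonadjacent pair, k names have k(k - 1) - 2 candidates in total, and 4 + k(k - 1) - 2
  -- < 4k for k = 2, 3, 4.
  M₃ = proj₂ (grow M₂)
  M₄ = proj₂ (grow M₃)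
  M₅ = proj₂ (grow M₄)

tail-∈ : ∀ {v w : A} {W} → w ∈ v ∷ W → w ≢ v → w ∈ W
tail-∈ (here w≡v)  w≢v = contradiction w≡v w≢v
tail-∈ (there w∈W) _   = w∈W

-- The four vertices of W form a K4 with degree sum at most 12, while five dense vertices have
-- degree sum at least 16. So v has two neighbours in W: one becomes the hub, the other follows v on
-- the path.
five⇒target : ∀ {G : Graph n} {v W} → Dense G (v ∷ W) → Dense G W → length W ≡ 4 → Target G
five⇒target {n} {G} {v} {W} dense dense′ W≡4 =
  let _ , M₂ = newNeighbour {G = G} uniq (point {G = G} (here refl)) (# 0) (≤-trans (from-yes (1 ≤? 2)) 2≤d)
      _ , M₃ = newNeighbour {G = G} uniq M₂ (# 1) 2≤d
      _ , M₄ = grow M₃ (from-yes (3 <? 5))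
      _ , M₅ = grow M₄ (from-yes (4 <? 5))
  in G , (λ _ → refl) , gem-contains {G = G} (arrange M₅)
  where
  open ≤-Reasoning
  uniq = Dense.unique dense
  d = degIn G (v ∷ W) v
  grow : ∀ {k} {F : List (Fact k)} {ρ} → Model G (v ∷ W) F ρ → k < 5 →
         ∃ λ w → Model G (v ∷ W) (weaken F) (w ◂ ρ)
  grow {ρ = ρ} M k<5 =
    let w , w∈W , w∉ρ = anotherMember ρ uniq (≤-trans k<5 (≤-reflexive (cong suc (≡.sym W≡4))))
    in w , extend {G = G} M w∈W w∉ρ
  total≤12 : total G W ≤ 12
  total≤12 = begin
    total G W        ≤⟨ ∑-mono W (λ w∈W → ℕ.≤-pred (≤-trans (degIn-< {G = G} (Dense.unique dense′) w∈W) (≤-reflexive W≡4))) ⟩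
    ∑ (λ _ → 3) W    ≡⟨ ∑-const 3 W ⟩
    length W * 3     ≡⟨ cong (_* 3) W≡4 ⟩
    12               ∎
  2≤d : 2 ≤ d
  2≤d = ℕ.*-cancelˡ-≤ 2 (ℕ.+-cancelʳ-≤ 16 4 (2 * d) (begin
    20                          ≡⟨ cong (λ l → 4 * suc l) W≡4 ⟨
    4 * suc (length W)          ≤⟨ Dense.size dense ⟩
    4 + total G (v ∷ W)         ≡⟨ cong (4 +_) (total-∷ G v W) ⟩
    4 + (2 * d + total G W)     ≤⟨ ℕ.+-monoʳ-≤ 4 (ℕ.+-monoʳ-≤ (2 * d) total≤12) ⟩
    4 + (2 * d + 12)            ≡⟨ ℕ.+-comm 4 _ ⟩
    2 * d + 12 + 4              ≡⟨ ℕ.+-assoc (2 * d) 12 4 ⟩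
    2 * d + 16                  ∎))
  -- The hub is w₁ and the path is v w₂ w₃ w₄.
  arrangement : Vec (Fin 5) 5
  arrangement = # 0 ∷ # 1 ∷ # 2 ∷ # 4 ∷ # 3 ∷ []
  arrange : ∀ {w₁ w₂ w₃ w₄} → let ρ = w₄ ◂ w₃ ◂ w₂ ◂ w₁ ◂ (λ _ → v) in
            ∀ {F} → {True (known? F (# 2) (# 4) true)} →
            {True (known? F (# 3) (# 4) true)} →
            Model G (v ∷ W) F ρ → Model G (v ∷ W) gem (ρ ∘ Vec.lookup arrangement)
  arrange {w₁} {w₂} {w₃} {w₄} {F} {e₂} {e₃} M = record
    { injective = lookup-injective (from-yes (Vec.allPairs? (λ i j → ¬? (i ≟ j)) arrangement)) _ _ ∘ injective M
    ; inside    = inside M ∘ Vec.lookup arrangement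
    ; holds     = ≡.trans (Graph.sym G _ _) (known {G = G} M (toWitness e₂))
                ∷ clique (# 2) (# 1)
                ∷ clique (# 1) (# 0)
                ∷ clique (# 0) (# 3)
                ∷ clique (# 1) (# 3)
                ∷ clique (# 2) (# 3)
                ∷ ≡.trans (Graph.sym G _ _) (known {G = G} M (toWitness e₃))
                ∷ []
    }
    where
    ρ = w₄ ◂ w₃ ◂ w₂ ◂ w₁ ◂ (λ _ → v)
    last : Fin 5
    last = # 4
    member : ∀ i → {True (¬? (i ≟ last))} → ρ i ∈ W
    member i {i≢} = tail-∈ (inside M i) (toWitness i≢ ∘ injective M {i} {last})
    clique : ∀ i j → {True (¬? (i ≟ last))} → {True (¬? (j ≟ last))} → {True (¬? (i ≟ j))} →
             adj G (ρ i) (ρ j) ≡ true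
    clique i j {i≢} {j≢} {i≢j} =
      four-complete {G = G} dense′ W≡4 (member i {i≢}) (member j {j≢}) (toWitness i≢j ∘ injective M)

-- The deletion lowers the threshold by 4 and the degree sum by twice the degree of v, which is at
-- most 4.
remove-sparse : ∀ {G : Graph n} {v W} → Dense G (v ∷ W) → degIn G (v ∷ W) v ≤ 2 → Dense G W
remove-sparse {G = G} {v} {W} dense d≤2 = record
  { unique = AllPairs.tail (Dense.unique dense)
  ; size   = ℕ.+-cancelˡ-≤ 4 _ _ (begin
      4 + 4 * length W                               ≡⟨ ℕ.*-suc 4 (length W) ⟨
      4 * suc (length W)                             ≤⟨ Dense.size dense ⟩
      4 + total G (v ∷ W)                            ≡⟨ cong (4 +_) (total-∷ G v W) ⟩
      4 + (2 * degIn G (v ∷ W) v + total G W)        ≤⟨ ℕ.+-monoʳ-≤ 4 (ℕ.+-monoˡ-≤ (total G W) (ℕ.*-monoʳ-≤ 2 d≤2)) ⟩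
      4 + (4 + total G W)                            ∎)
  }
  where open ≤-Reasoning

Dense-↭ : ∀ {G : Graph n} {W W′} → W ↭ W′ → Dense G W → Dense G W′
Dense-↭ {G = G} W↭ dense = record
  { unique = Unique-↭ W↭ (Dense.unique dense)
  ; size   = ℕ.≤-trans (≤-reflexive (cong (4 *_) (≡.sym (↭-length W↭))))
               (≤-trans (Dense.size dense) (≤-reflexive (cong (4 +_) (total-↭ G W↭))))
  }

-- Induction on the number m of vertices beyond five. Without a vertex of degree at most 2 the set
-- is a core; with one, the deletion reduces m or, when m = 0, leaves four vertices.
dense⇒target : ∀ {G : Graph n} m {W} → length W ≡ 5 + m → Dense G W → Target G
dense⇒target {G = G} m {W} W≡ dense with Any.any? (λ v → degIn G W v ≤? 2) W
... | no ¬sparse = core⇒target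
  record { dense = dense ; minDegree = λ v∈W → ℕ.≰⇒> (¬sparse ∘ lose v∈W) }
  (≤-trans (ℕ.m≤m+n 5 m) (≤-reflexive (≡.sym W≡)))
... | yes sparse
  with v , v∈W , d≤2 ← find sparse
  with W′ , W↭ ← extract v∈W
  with dense-∷ ← Dense-↭ {G = G} W↭ dense
  with dense′ ← remove-sparse {G = G} dense-∷
                  (subst (_≤ 2) (∑-↭ (λ u → [ adj G v u ]) W↭) d≤2)
  with m
... | zero   = five⇒target {G = G} dense-∷ dense′ (ℕ.suc-injective (≡.trans (≡.sym (↭-length W↭)) W≡))
... | suc m′ = dense⇒target m′ (ℕ.suc-injective (≡.trans (≡.sym (↭-length W↭)) W≡)) dense′

-- The bound on the degree sum makes the whole vertex set dense.
upper : ∀ n → 5 ≤ n → SigmaProperty 5 K5-P3 n (4 * n ∸ 4)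
upper n 5≤n S (G , realizes) large =
  let G′ , same , G′∋ = dense⇒target {G = G} (n ∸ 5) (≡.trans (length-allFin n) (≡.sym (ℕ.m+[n∸m]≡n 5≤n))) record
        { unique = Unique.allFin⁺ n
        ; size   = begin
            4 * length (allFin n)       ≡⟨ cong (4 *_) (length-allFin n) ⟩
            4 * n                       ≤⟨ ℕ.m≤n+m∸n (4 * n) 4 ⟩
            4 + (4 * n ∸ 4)             ≤⟨ ℕ.+-monoʳ-≤ 4 large ⟩
            4 + σ n S                   ≡⟨ cong (4 +_) (∑-cong (allFin n) λ {v} _ → realizes v) ⟨
            4 + total G (allFin n)      ∎
        }
  in G′ , (λ v → ≡.trans (same v) (realizes v)) , G′∋
  where
  open ≤-Reasoning

-- The extremal graph and the lower bound.

hub? : Fin n → Bool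
hub? zero          = true
hub? (suc zero)    = true
hub? (suc (suc _)) = false

-- The join K2 + (n - 2)K1: distinct vertices are adjacent when at least one of them is among the
-- first two.
doubleStar : ∀ n → Graph n
doubleStar n = record
  { adj    = λ u w → (hub? u ∨ hub? w) ∧ not (does (u ≟ w))
  ; sym    = λ u w → cong₂ (λ b c → b ∧ not c) (∨-comm (hub? u) (hub? w)) (≟-comm u w)
  ; irrefl = λ v → ≡.trans (cong (λ c → (hub? v ∨ hub? v) ∧ not c) (dec-true (v ≟ v) refl)) (∧-zeroʳ _)
  }
  where
  ≟-comm : ∀ (u w : Fin n) → does (u ≟ w) ≡ does (w ≟ u)
  ≟-comm u w with w ≟ u
  ... | yes refl = dec-true (u ≟ u) refl
  ... | no  w≢u  = dec-false (u ≟ w) (w≢u ∘ ≡.sym)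

∑-allFin : ∀ {m} (f : Fin (2 + m) → ℕ) →
           ∑ f (allFin (2 + m)) ≡ f zero + (f (suc zero) + ∑ (λ i → f (suc (suc i))) (allFin m))
∑-allFin {m} f = cong (λ xs → f zero + (f (suc zero) + sum xs))
  (≡.trans (map-tabulate (λ i → suc (suc i)) f) (≡.sym (map-tabulate id (λ i → f (suc (suc i))))))

∑-allFin-const : ∀ m c → ∑ (λ (_ : Fin m) → c) (allFin m) ≡ m * c
∑-allFin-const m c = ≡.trans (∑-const c (allFin m)) (cong (_* c) (length-allFin m))

module _ (m : ℕ) where

  private
    D = doubleStar (2 + m)

  deg-hub₀ : deg D zero ≡ 1 + m
  deg-hub₀ = ≡.trans (∑-allFin {m} λ u → [ adj D zero u ])
    (cong suc (≡.trans (∑-allFin-const m 1) (ℕ.*-identityʳ m)))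

  deg-hub₁ : deg D (suc zero) ≡ 1 + m
  deg-hub₁ = ≡.trans (∑-allFin {m} λ u → [ adj D (suc zero) u ])
    (cong suc (≡.trans (∑-allFin-const m 1) (ℕ.*-identityʳ m)))

  deg-leaf : ∀ i → deg D (suc (suc i)) ≡ 2
  deg-leaf i = ≡.trans (∑-allFin {m} λ u → [ adj D (suc (suc i)) u ])
    (cong (2 +_) (≡.trans (∑-allFin-const m 0) (ℕ.*-zeroʳ m)))

  -- For n = m + 2 this is 4n - 6, the largest even number below 4n - 4, with the factor 2 set apart
  -- for comparison with even bounds.
  σ-doubleStar : σ (2 + m) (deg D) ≡ (1 + m * 2) * 2
  σ-doubleStar = begin
    σ (2 + m) (deg D)                     ≡⟨ ∑-allFin (deg D) ⟩
    deg D zero + (deg D (suc zero) + ∑ (λ i → deg D (suc (suc i))) (allFin m))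
      ≡⟨ cong₂ _+_ deg-hub₀ (cong₂ _+_ deg-hub₁ (≡.trans (∑-cong (allFin m) λ {i} _ → deg-leaf i) (∑-allFin-const m 2))) ⟩
    1 + m + (1 + m + m * 2)               ≡⟨ regroup m ⟩
    (1 + m * 2) * 2                       ∎
    where
    open ≡-Reasoning
    regroup : ∀ x → 1 + x + (1 + x + x * 2) ≡ (1 + x * 2) * 2
    regroup = solve-∀

-- An embedding maps the neighbours of i injectively to neighbours of its image.
image-degree : ∀ {G : Graph n} (H⊆G : Contains G K5-P3) i → deg K5-P3 i ≤ deg G (proj₁ H⊆G i)
image-degree {G = G} (f , f-inj , edges) i = begin
  deg K5-P3 i              ≡⟨ count-filter (adj K5-P3 i) (allFin 5) ⟩
  length nbrs              ≡⟨ length-map f nbrs ⟨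
  length (map f nbrs)      ≤⟨ count-≥ (Unique.map⁺ f-inj (Unique.filter⁺ nbr? (Unique.allFin⁺ 5))) preserved ⟩
  deg G (f i)              ∎
  where
  open ≤-Reasoning
  nbr? = λ j → adj K5-P3 i j Bool.≟ true
  nbrs = filter nbr? (allFin 5)
  preserved : ∀ {w} → w ∈ map f nbrs → w ∈ allFin _ × adj G (f i) w ≡ true
  preserved w∈ with j , j∈ , refl ← ∈-map⁻ f w∈ =
    ∈-allFin _ , edges i j (proj₂ (∈-filter⁻ nbr? {xs = allFin 5} j∈))

doubleStar-free : ∀ m → ¬ PotentiallyGraphical 5 (2 + m) K5-P3 (deg (doubleStar (2 + m)))
doubleStar-free m (G , realizes , f , f-inj , edges) =
  contradiction (length-⊆ (Unique.map⁺ f-inj distinct) hubs) (ℕ.<⇒≱ ≤-refl)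
  where
  degree≥3 : List (Fin 5)
  -- The two ends of the removed path and the vertex off it; the inner vertices of that path have
  -- degree 2.
  degree≥3 = # 0 ∷ # 3 ∷ # 4 ∷ []
  distinct : Unique degree≥3
  distinct = from-yes (AllPairs.allPairs? (λ i j → ¬? (i ≟ j)) degree≥3)
  is-hub : ∀ v → 3 ≤ deg G v → v ∈ zero ∷ suc zero ∷ []
  is-hub zero          _ = here refl
  is-hub (suc zero)    _ = there (here refl)
  is-hub (suc (suc i)) 3≤ = contradiction
    (subst (3 ≤_) (≡.trans (realizes _) (deg-leaf m i)) 3≤) (ℕ.<⇒≱ ≤-refl)
  hubs : map f degree≥3 ⊆ zero ∷ suc zero ∷ []
  hubs v∈ with i , i∈ , refl ← ∈-map⁻ f v∈ = is-hub (f i)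
    (≤-trans (All.lookup {P = λ i → 3 ≤ deg K5-P3 i} (from-yes (All.all? (λ i → 3 ≤? deg K5-P3 i) degree≥3)) i∈)
             (image-degree {G = G} (f , f-inj , edges) i))

lower : ∀ m l → 2 ∣ l → SigmaProperty 5 K5-P3 (2 + m) l → (1 + m) * 2 * 2 ≤ l
lower m l (divides q refl) property with (1 + m) * 2 * 2 ≤? q * 2
... | yes p = p
... | no ¬p = contradiction (property (deg D) (D , λ _ → refl) (begin
  -- By parity, an even number below 4n - 4 is at most 4n - 6, so the property would apply to the
  -- degree sequence of `D`.
  q * 2                 ≤⟨ ℕ.*-monoˡ-≤ 2 (ℕ.≤-pred (ℕ.*-cancelʳ-< 2 q ((1 + m) * 2) (ℕ.≰⇒> ¬p))) ⟩
  (1 + m * 2) * 2       ≡⟨ σ-doubleStar m ⟨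
  σ (2 + m) (deg D)     ∎)) (doubleStar-free m)
  where
  open ≤-Reasoning
  D = doubleStar (2 + m)

theorem2 : ∀ (n : ℕ) → 5 ≤ n → IsSigma 5 K5-P3 n (4 * n ∸ 4)
theorem2 (suc zero) (s≤s ())
theorem2 n@(suc (suc m)) 5≤n = divides ((1 + m) * 2) bound , upper n 5≤n ,
  λ l 2∣l property → subst (_≤ l) (≡.sym bound) (lower m l 2∣l property)
  where
  bound : 4 * n ∸ 4 ≡ (1 + m) * 2 * 2
  bound = begin
    4 * (2 + m) ∸ 4            ≡⟨ cong (_∸ 4) (ℕ.*-suc 4 (1 + m)) ⟩
    4 + 4 * (1 + m) ∸ 4        ≡⟨ ℕ.m+n∸m≡n 4 _ ⟩
    4 * (1 + m)                ≡⟨ ℕ.*-comm 4 (1 + m) ⟩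
    (1 + m) * 4                ≡⟨ ℕ.*-assoc (1 + m) 2 2 ⟨
    (1 + m) * 2 * 2            ∎
    where open ≡-Reasoning
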